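{- Let $G$ be a simple signed graph with underlying unsigned graph $\underline{G}$. The following statements hold. (i) If $\underline{G}$ is $K_4$-minor-free, then $\chi(G)\le 3$. (ii) If $G$ is a union of two forests (that is, if the edge arboricity satisfies $a'(\underline{G})\le 2$), then $\chi(G)\le 4$. (iii) For every integer $k\ge 1$, if the vertex arboricity satisfies $a(\underline{G})\le k$, then $\chi(G)\le 2k$.
   Context: All graphs are finite and nonempty. A signed graph $G$ is a graph in which each edge $e$ is labelled with a sign $\sigma(e)\in\{+1,-1\}$; its underlying unsigned graph, obtained by forgetting the signs, is denoted by $\underline{G}$, and $G$ is simple if $\underline{G}$ has no loops and no parallel edges. A proper colouring of $G$ is a mapping $\phi\colon V(G)\to\mathbb{Z}$ such that for each edge $e=uv$ of $G$ we have $\phi(u)\neq\sigma(e)\phi(v)$. For $n\ge1$ let $M_n=\{\pm1,\pm2,\ldots,\pm k\}$ if $n=2k$, and $M_n=\{0,\pm1,\pm2,\ldots,\pm k\}$ if $n=2k+1$. An $n$-colouring of $G$ is a proper colouring of $G$ using colours from $M_n$. The chromatic number $\chi(G)$ of a signed graph $G$ is the smallest $n\ge 1$ such that $G$ admits an $n$-colouring. The vertex arboricity $a(H)$ of a graph $H$ is the minimum number of subsets into which $V(H)$ can be partitioned so that each subset induces a forest. The edge arboricity $a'(H)$ of $H$ is the minimum number of forests into which $E(H)$ can be partitioned (equivalently, the minimum number of acyclic subgraphs whose union covers $E(H)$). -}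

module Defs where

open import Data.Fin.Base using (Fin; zero; suc; inject₁; fromℕ)
open import Data.Integer.Base using (ℤ; 0ℤ; ∣_∣; _◃_) renaming (_*_ to _*ᶻ_)
open import Data.Maybe.Base using (Maybe; just; nothing)
open import Data.Nat.Base using (ℕ; _+_; _*_; _≤_)
open import Data.Product.Base using (Σ-syntax; ∃-syntax; _×_; _,_; proj₁)
open import Data.Sign.Base using (Sign)
open import Data.Sum.Base using (_⊎_)
open import Function.Definitions using (Injective)
open import Relation.Binary.Construct.Closure.ReflexiveTransitive using (Star)
open import Relation.Binary.Definitions using (Symmetric; Irreflexive)
open import Relation.Binary.PropositionalEquality
  using (_≡_; _≢_; refl; sym; trans; ≢-sym)
open import Relation.Nullary.Negation using (¬_)

IsLeast : (ℕ → Set) → ℕ → Set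
IsLeast P m = P m × (∀ j → P j → m ≤ j)

------------------------------------------------------------------------
-- Simple unsigned graphs

record Graph (V : Set) : Set₁ where
  field
    Adj        : V → V → Set
    adj-sym    : Symmetric Adj
    adj-irrefl : Irreflexive _≡_ Adj

open Graph public

K : (m : ℕ) → Graph (Fin m)
K m = record
  { Adj        = _≢_
  ; adj-sym    = ≢-sym
  ; adj-irrefl = λ u≡v u≢v → u≢v u≡v
  }

-- The subgraph induced by the vertex class { v | f v ≡ c }.  It is only used
-- for f with values in Fin m or Maybe (Fin m), where equality proofs are
-- unique, so that vertices are not duplicated by the Σ-type.
inducedClass : {V C : Set} → Graph V → (f : V → C) (c : C) →
               Graph (Σ[ v ∈ V ] f v ≡ c)
inducedClass G f c = record
  { Adj        = λ u v → Adj G (proj₁ u) (proj₁ v)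
  ; adj-sym    = adj-sym G
  ; adj-irrefl = λ { refl → adj-irrefl G refl }
  }

Connected : {V : Set} → Graph V → Set
Connected {V} G = V × (∀ u v → Star (Adj G) u v)

-- A cycle on the 3 + m distinct vertices vertex 0, …, vertex (2 + m).
record Cycle {V : Set} (G : Graph V) : Set where
  field
    m        : ℕ
    vertex   : Fin (3 + m) → V
    distinct : Injective _≡_ _≡_ vertex
    step     : ∀ (i : Fin (2 + m)) → Adj G (vertex (inject₁ i)) (vertex (suc i))
    closing  : Adj G (vertex (fromℕ (2 + m))) (vertex zero)

IsForest : {V : Set} → Graph V → Set
IsForest G = ¬ Cycle G

-- H is a minor of G: there are disjoint, nonempty, connected branch sets
-- { v | branch v ≡ just h } in G, one for each vertex h of H, such that
-- adjacent vertices of H have branch sets joined by an edge of G.  Vertices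
-- mapped to nothing are deleted.
record _IsMinorOf_ {W V : Set} (H : Graph W) (G : Graph V) : Set where
  field
    branch    : V → Maybe W
    connected : ∀ h → Connected (inducedClass G branch (just h))
    edges     : ∀ h h′ → Adj H h h′ →
                ∃[ u ] ∃[ v ] (branch u ≡ just h × branch v ≡ just h′ × Adj G u v)

-- Classes of a partition are given by the fibres of a map to Fin m.  They may
-- be empty, which does not affect the minimum number of classes.
VertexForestPartition : {V : Set} → Graph V → ℕ → Set
VertexForestPartition {V} G m =
  Σ[ f ∈ (V → Fin m) ] (∀ i → IsForest (inducedClass G f i))

IsVertexArboricity : {V : Set} → Graph V → ℕ → Set
IsVertexArboricity G = IsLeast (VertexForestPartition G)

-- A labelling of the unordered edges: the field class-sym says that the label
-- depends neither on the orientation nor on the proof of adjacency.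
record EdgeClasses {V : Set} (G : Graph V) (m : ℕ) : Set where
  field
    class     : ∀ {u v} → Adj G u v → Fin m
    class-sym : ∀ {u v} (e : Adj G u v) (e′ : Adj G v u) → class e ≡ class e′

open EdgeClasses public

edgeClass : {V : Set} (G : Graph V) {m : ℕ} → EdgeClasses G m → Fin m → Graph V
edgeClass G f i = record
  { Adj        = λ u v → Σ[ e ∈ Adj G u v ] class f e ≡ i
  ; adj-sym    = λ { (e , p) →
                     adj-sym G e , trans (class-sym f (adj-sym G e) e) p }
  ; adj-irrefl = λ { u≡v (e , _) → adj-irrefl G u≡v e }
  }

EdgeForestPartition : {V : Set} → Graph V → ℕ → Set
EdgeForestPartition G m =
  Σ[ f ∈ EdgeClasses G m ] (∀ i → IsForest (edgeClass G f i))

IsEdgeArboricity : {V : Set} → Graph V → ℕ → Set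
IsEdgeArboricity G = IsLeast (EdgeForestPartition G)

------------------------------------------------------------------------
-- Simple signed graphs

-- label u v ≡ just s means that uv is an edge of sign s, and
-- label u v ≡ nothing that u and v are not adjacent.
record SimpleSignedGraph (n : ℕ) : Set where
  field
    label         : Fin n → Fin n → Maybe Sign
    label-sym     : ∀ u v → label u v ≡ label v u
    label-no-loop : ∀ v → label v v ≡ nothing

open SimpleSignedGraph public

underlying : ∀ {n} → SimpleSignedGraph n → Graph (Fin n)
underlying G = record
  { Adj        = λ u v → ∃[ s ] label G u v ≡ just s
  ; adj-sym    = λ { {u} {v} (s , p) → s , trans (label-sym G v u) p }
  ; adj-irrefl = λ { {u} refl (s , p) → nothing≢just (trans (sym (label-no-loop G u)) p) }
  }
  where
  nothing≢just : {s : Sign} → ¬ (nothing ≡ just s)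
  nothing≢just ()

-- s ◃ 1 is the integer +1 or -1 given by the sign s.
IsProperColouring : ∀ {n} → SimpleSignedGraph n → (Fin n → ℤ) → Set
IsProperColouring G φ =
  ∀ u v s → label G u v ≡ just s → φ u ≢ (s ◃ 1) *ᶻ φ v

-- z ∈ {±1, …, ±k}
_∈±_ : ℤ → ℕ → Set
z ∈± k = 1 ≤ ∣ z ∣ × ∣ z ∣ ≤ k

_∈M_ : ℤ → ℕ → Set
z ∈M n = ∃[ k ] ((n ≡ 2 * k     × z ∈± k)
               ⊎ (n ≡ 2 * k + 1 × (z ≡ 0ℤ ⊎ z ∈± k)))

Colourable : ∀ {n} → SimpleSignedGraph n → ℕ → Set
Colourable {n} G c =
  Σ[ φ ∈ (Fin n → ℤ) ] (IsProperColouring G φ × (∀ v → φ v ∈M c))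

IsChromaticNumber : ∀ {n} → SimpleSignedGraph n → ℕ → Set
IsChromaticNumber G = IsLeast (λ c → 1 ≤ c × Colourable G c)

{-# OPTIONS --safe #-}
module Submission where

-- Each coloured neighbour, whatever the sign of the edge, forbids one colour, so a
-- d-degenerate graph can be coloured greedily from any d + 1 integers.
--
-- A forest is 1-degenerate, so it has a colouring by ±1; scaling
-- class i of a vertex partition by i + 1 gives (iii).  A proper 2-colouring of the
-- second of two forests, ignoring signs, is a partition into two classes whose
-- induced edges all lie in the first forest, so (ii) follows from (iii).
--
-- For (i), K₄-minor-free graphs are 2-degenerate, and the colours 0, ±1 suffice: if
-- a graph is not 2-degenerate, some nonempty set of vertices induces minimum
-- degree at least 3; split it into a connected part A and the rest B, so that B contains a
-- cycle, and move a neighbour s of A from B to A as long as B − s keeps a cycle.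
-- If A has no neighbour left in B, restart inside B.  Otherwise B − s is
-- acyclic for every neighbour s of A in B, so every cycle of B passes through all
-- of them.  The forest B − s has two vertices of degree at most 1, and these are
-- again neighbours of A.  So a cycle of B meets at least three neighbours of A,
-- which gives a K₄ minor.

open import Defs
open import Data.Empty using (⊥)
open import Data.Fin.Base as Fin
  using (Fin; zero; suc; toℕ; inject₁; inject≤; fromℕ; fromℕ<; lower₁; splitAt; _↑ˡ_; _↑ʳ_; finToFun; funToFin)
import Data.Fin.Properties as Finₚ
open import Data.Fin.Induction using (<-weakInduction)
open import Data.Fin.Patterns using (0F; 1F; 2F)
open import Data.Fin.Subset using (Subset; Nonempty; ⁅_⁆; _∈_; _∉_; _∪_; _-_; ∣_∣; ⊤)
open import Data.Fin.Subset.Properties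
  using (_∈?_; nonempty?; ∈⊤; p─q⊆p; p─q─q≡p─q; x∈p∧x≢y⇒x∈p-y; x∈p⇒∣p-x∣<∣p∣; x∈p∪q⁺; x∈p∪q⁻; x∈⁅x⁆; x∈⁅y⁆⇒x≡y)
open import Data.Integer.Base using (ℤ; +_; -[1+_]; -_; 0ℤ; 1ℤ; -1ℤ; _◃_) renaming (_*_ to _*ᶻ_; ∣_∣ to ∣_∣ᶻ)
import Data.Integer.Properties as ℤₚ
open import Data.Maybe.Base using (Maybe; just; nothing; fromMaybe)
open import Data.Nat.Base as ℕ using (ℕ; zero; suc; NonZero; _+_; _*_; _≤_; _<_; z≤n; s≤s)
import Data.Nat.Properties as ℕₚ
open import Data.Product.Base using (Σ-syntax; ∃-syntax; _×_; _,_; proj₁; proj₂)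
open import Data.Sign.Base as Sign using (Sign)
open import Data.Sum.Base using (_⊎_; inj₁; inj₂; [_,_]′)
open import Data.Vec.Functional using (Vector; []; _∷_; updateAt)
open import Data.Vec.Functional.Properties using (updateAt-updates; updateAt-minimal)
open import Function.Base using (_∘_; const)
open import Function.Definitions using (Injective)
open import Relation.Binary.Construct.Closure.ReflexiveTransitive as Star using (Star; ε; _◅_; _◅◅_)
open import Relation.Binary.Definitions using (tri<; tri≈; tri>)
open import Relation.Binary.PropositionalEquality
open import Relation.Nullary.Decidable using (Dec; yes; no; ¬?; _×-dec_; _⊎-dec_; map′; decidable-stable)
open import Relation.Nullary.Negation using (¬_; contradiction)

-- Cycles and minimum degree

mapCycle : {V : Set} {G H : Graph V} → (∀ {u v} → Adj G u v → Adj H u v) → Cycle G → Cycle H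
mapCycle h C = record
  { m = m ; vertex = vertex ; distinct = distinct ; step = h ∘ step ; closing = h closing }
  where open Cycle C

x∈p-y⇒x∈p : ∀ {n} {p : Subset n} {x y} → x ∈ p - y → x ∈ p
x∈p-y⇒x∈p {p = p} {y = y} = p─q⊆p p ⁅ y ⁆

x∈p-y⇒x≢y : ∀ {n} {p : Subset n} {x y} → x ∈ p - y → x ≢ y
x∈p-y⇒x≢y {p = p} x∈p-x refl =
  ℕₚ.<-irrefl (cong ∣_∣ (p─q─q≡p─q p ⁅ _ ⁆)) (x∈p⇒∣p-x∣<∣p∣ x∈p-x)

<⇒inject₁ : ∀ {n} {i j : Fin (suc n)} → i Fin.< j → ∃[ i′ ] inject₁ i′ ≡ i
<⇒inject₁ {n} {i} {j} i<j = lower₁ i n≢i , Finₚ.inject₁-lower₁ i n≢i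
  where
  n≢i : n ≢ toℕ i
  n≢i n≡i = ℕₚ.<-irrefl (sym n≡i) (ℕₚ.<-≤-trans i<j (ℕ.s≤s⁻¹ (Finₚ.toℕ<n j)))

module _ {n : ℕ} (H : Graph (Fin n)) where

  CycleIn : Subset n → Set
  CycleIn B = Σ[ C ∈ Cycle H ] (∀ i → Cycle.vertex C i ∈ B)

  -- Degree bounds without counting: no single vertex (no two vertices) can exhaust the neighbours
  -- of `v` in `B`. Refuting this yields the vertices that `Covered` asks for.
  Deg≥2 Deg≥3 : Subset n → Fin n → Set
  Deg≥2 B v = ∀ q → ∃[ w ] (w ∈ B × Adj H v w × w ≢ q)
  Deg≥3 B v = ∀ q q′ → ∃[ w ] (w ∈ B × Adj H v w × w ≢ q × w ≢ q′)

  -- The path is extended at its head P zero until the head has a neighbour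
  -- on the path other than P 1F.
  closePath : ∀ {B} fuel m → n < fuel + (2 + m) → (P : Vector (Fin n) (2 + m)) →
    Injective _≡_ _≡_ P → (∀ i → P i ∈ B) →
    (∀ (i : Fin (1 + m)) → Adj H (P (inject₁ i)) (P (suc i))) →
    (∀ w → w ∈ B → (∀ (i : Fin (1 + m)) → w ≢ P (suc i)) → Deg≥2 B w) →
    CycleIn B
  -- Without fuel the path would have more than `n` distinct vertices.
  closePath zero m n<m P inj P∈B steps deg =
    contradiction (Finₚ.injective⇒≤ inj) (ℕₚ.<⇒≱ n<m)
  closePath {B} (suc fuel) m n<m P inj P∈B steps deg
    with deg (P zero) (P∈B zero) (λ i eq → Finₚ.0≢1+n (inj eq)) (P 1F)
  ... | w , w∈B , adj , w≢P1 with Finₚ.any? (λ i → P i Finₚ.≟ w)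
  ... | yes (0F , eq) = contradiction adj (adj-irrefl H eq)
  ... | yes (1F , eq) = contradiction (sym eq) w≢P1
  -- The head is adjacent to `P (suc (suc k))`, so the segment up to there, with at least three
  -- vertices, closes into a cycle.
  ... | yes (suc (suc k) , eq) = record
    { m = toℕ k
    ; vertex = P ∘ ι
    ; distinct = λ {i} {j} e → Finₚ.inject≤-injective le le i j (inj e)
    ; step = λ i → subst (λ j → Adj H (P j) (P (ι (suc i)))) (inject₁-ι i) (steps (inject≤ i (ℕ.s≤s⁻¹ le)))
    ; closing = subst (λ x → Adj H x (P zero)) (trans (sym eq) (cong P last-ι)) (adj-sym H adj)
    } , λ i → P∈B (ι i)
    where
    le : 3 + toℕ k ≤ 2 + m
    le = s≤s (s≤s (Finₚ.toℕ<n k))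
    ι : Fin (3 + toℕ k) → Fin (2 + m)
    ι i = inject≤ i le
    inject₁-ι : ∀ i → inject₁ (inject≤ i (ℕ.s≤s⁻¹ le)) ≡ ι (inject₁ i)
    inject₁-ι i = Finₚ.toℕ-injective (begin
      toℕ (inject₁ (inject≤ i (ℕ.s≤s⁻¹ le))) ≡⟨ Finₚ.toℕ-inject₁ _ ⟩
      toℕ (inject≤ i (ℕ.s≤s⁻¹ le))           ≡⟨ Finₚ.toℕ-inject≤ i _ ⟩
      toℕ i                                  ≡⟨ Finₚ.toℕ-inject₁ i ⟨
      toℕ (inject₁ i)                        ≡⟨ Finₚ.toℕ-inject≤ (inject₁ i) le ⟨
      toℕ (ι (inject₁ i))                    ∎)
      where open ≡-Reasoning
    last-ι : suc (suc k) ≡ ι (fromℕ (2 + toℕ k))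
    last-ι = Finₚ.toℕ-injective (sym (trans (Finₚ.toℕ-inject≤ _ le) (Finₚ.toℕ-fromℕ _)))
  ... | no w∉P = closePath fuel (suc m) (subst (n <_) (sym (ℕₚ.+-suc fuel (2 + m))) n<m)
      (w ∷ P) inj′ P′∈B steps′ (λ v v∈B v∉P → deg v v∈B (v∉P ∘ suc))
    where
    inj′ : Injective _≡_ _≡_ (w ∷ P)
    inj′ {zero}  {zero}  _ = refl
    inj′ {zero}  {suc j} e = contradiction (j , sym e) w∉P
    inj′ {suc i} {zero}  e = contradiction (i , e) w∉P
    inj′ {suc i} {suc j} e = cong suc (inj e)
    P′∈B : ∀ i → (w ∷ P) i ∈ B
    P′∈B zero = w∈B
    P′∈B (suc i) = P∈B i
    steps′ : ∀ i → Adj H ((w ∷ P) (inject₁ i)) ((w ∷ P) (suc i))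
    steps′ zero = adj-sym H adj
    steps′ (suc i) = steps i

  -- The path starts as the edge from `v` to `x` and grows only at the end opposite to `x`, so
  -- degrees are queried only at other vertices.
  cycleThroughException : ∀ {B x v} → x ∈ B → v ∈ B → Adj H v x →
    (∀ w → w ∈ B → w ≢ x → Deg≥2 B w) → CycleIn B
  cycleThroughException {B} {x} {v} x∈B v∈B vx deg =
    closePath n 0 (ℕₚ.m<m+n n (s≤s z≤n)) P inj P∈B (λ { zero → vx }) (λ w w∈B w∉ → deg w w∈B (w∉ zero))
    where
    P : Vector (Fin n) 2
    P = v ∷ x ∷ []
    inj : Injective _≡_ _≡_ P
    inj {0F} {0F} _ = refl
    inj {0F} {1F} e = contradiction vx (adj-irrefl H e)
    inj {1F} {0F} e = contradiction vx (adj-irrefl H (sym e))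
    inj {1F} {1F} _ = refl
    P∈B : ∀ i → P i ∈ B
    P∈B 0F = v∈B
    P∈B 1F = x∈B

  minDegree2⇒cycle : ∀ {B x} → x ∈ B → (∀ w → w ∈ B → Deg≥2 B w) → CycleIn B
  minDegree2⇒cycle {B} {x} x∈B deg =
    let v , v∈B , xv , _ = deg x x∈B x in
    cycleThroughException x∈B v∈B (adj-sym H xv) (λ w w∈B _ → deg w w∈B)

  module _ (adj? : ∀ u v → Dec (Adj H u v)) where

    -- Either an edge at `x` starts the path, or `x` is isolated in `B`: then deleting it lowers no
    -- degree, and `y` keeps the rest nonempty. Hence an acyclic `B` with two vertices has a vertex
    -- of degree at most 1 other than `x`.
    exceptOneMinDegree2⇒cycle : ∀ {B x y} → x ∈ B → y ∈ B → y ≢ x →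
      (∀ w → w ∈ B → w ≢ x → Deg≥2 B w) → CycleIn B
    exceptOneMinDegree2⇒cycle {B} {x} {y} x∈B y∈B y≢x deg
      with Finₚ.any? (λ v → (v ∈? B) ×-dec adj? v x)
    ... | yes (v , v∈B , vx) = cycleThroughException x∈B v∈B vx deg
    ... | no isolated =
      let C , C∈ = minDegree2⇒cycle (x∈p∧x≢y⇒x∈p-y y∈B y≢x) deg′ in C , x∈p-y⇒x∈p ∘ C∈
      where
      deg′ : ∀ w → w ∈ B - x → Deg≥2 (B - x) w
      deg′ w w∈ q with deg w (x∈p-y⇒x∈p w∈) (x∈p-y⇒x≢y w∈) q
      ... | v , v∈B , wv , v≢q = v , x∈p∧x≢y⇒x∈p-y v∈B v≢x , wv , v≢q
        where
        v≢x : v ≢ x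
        v≢x refl = isolated (w , x∈p-y⇒x∈p w∈ , wv)

    deg≥2? : ∀ B v → Dec (Deg≥2 B v)
    deg≥2? B v = Finₚ.all? λ q → Finₚ.any? λ w →
      (w ∈? B) ×-dec (adj? v w ×-dec ¬? (w Finₚ.≟ q))

    deg≥3? : ∀ B v → Dec (Deg≥3 B v)
    deg≥3? B v = Finₚ.all? λ q → Finₚ.all? λ q′ → Finₚ.any? λ w →
      (w ∈? B) ×-dec (adj? v w ×-dec (¬? (w Finₚ.≟ q) ×-dec ¬? (w Finₚ.≟ q′)))

    -- Degree at most `d` within `B`, witnessed by a list that greedy colouring turns into `d`
    -- forbidden colours.
    Covered : ℕ → Subset n → Fin n → Set
    Covered d B v =
      Σ[ q ∈ Vector (Fin n) d ] (∀ w → w ∈ B → Adj H v w → ∃[ i ] w ≡ q i)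

    ¬deg≥2⇒covered : ∀ {B v} → ¬ Deg≥2 B v → Covered 1 B v
    ¬deg≥2⇒covered {B} {v} ¬deg
      with Finₚ.¬∀⟶∃¬ n _ (λ q → Finₚ.any? λ w →
             (w ∈? B) ×-dec (adj? v w ×-dec ¬? (w Finₚ.≟ q))) ¬deg
    ... | q , none = const q , λ w w∈B vw →
      0F , decidable-stable (w Finₚ.≟ q) (λ w≢q → none (w , w∈B , vw , w≢q))

    ¬deg≥3⇒covered : ∀ {B v} → ¬ Deg≥3 B v → Covered 2 B v
    ¬deg≥3⇒covered {B} {v} ¬deg
      with Finₚ.¬∀⟶∃¬ n _ (λ q → Finₚ.all? λ q′ → Finₚ.any? λ w →
             (w ∈? B) ×-dec (adj? v w ×-dec (¬? (w Finₚ.≟ q) ×-dec ¬? (w Finₚ.≟ q′)))) ¬deg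
    ... | q , ¬deg′
      with Finₚ.¬∀⟶∃¬ n _ (λ q′ → Finₚ.any? λ w →
             (w ∈? B) ×-dec (adj? v w ×-dec (¬? (w Finₚ.≟ q) ×-dec ¬? (w Finₚ.≟ q′)))) ¬deg′
    ... | q′ , none = q ∷ q′ ∷ [] , cover
      where
      cover : ∀ w → w ∈ B → Adj H v w → ∃[ i ] w ≡ (q ∷ q′ ∷ []) i
      cover w w∈B vw with w Finₚ.≟ q | w Finₚ.≟ q′
      ... | yes w≡q | _        = 0F , w≡q
      ... | no _    | yes w≡q′ = 1F , w≡q′
      ... | no w≢q  | no w≢q′  = contradiction (w , w∈B , vw , w≢q , w≢q′) none

    IsDegenerate : ℕ → Set
    IsDegenerate d = ∀ B → Nonempty B → ∃[ v ] (v ∈ B × Covered d B v)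

    forest⇒1-degenerate : IsForest H → IsDegenerate 1
    forest⇒1-degenerate acyclic B (x , x∈B)
      with Finₚ.any? (λ v → (v ∈? B) ×-dec ¬? (deg≥2? B v))
    ... | yes (v , v∈B , ¬deg) = v , v∈B , ¬deg≥2⇒covered ¬deg
    ... | no none = contradiction (proj₁ (minDegree2⇒cycle x∈B λ w w∈B →
      decidable-stable (deg≥2? B w) λ ¬deg → none (w , w∈B , ¬deg))) acyclic

-- Minors

just-irrelevant : {A : Set} {x : Maybe A} {y : A} (p q : x ≡ just y) → p ≡ q
just-irrelevant refl refl = refl

module _ {n : ℕ} (H : Graph (Fin n)) where

  StepIn : (Fin n → Set) → Fin n → Fin n → Set
  StepIn S u v = Adj H u v × S u × S v

  -- A model of a complete minor by decidable predicates. Paths run through plain vertices of `H`,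
  -- without the membership proofs of `inducedClass`.
  record BranchSets (m : ℕ) : Set₁ where
    field
      Branch    : Fin m → Fin n → Set
      branch?   : ∀ v h → Dec (Branch h v)
      disjoint  : ∀ {v h h′} → Branch h v → Branch h′ v → h ≡ h′
      nonempty  : ∀ h → ∃[ v ] Branch h v
      connected : ∀ h {u v} → Branch h u → Branch h v → Star (StepIn (Branch h)) u v
      edges     : ∀ h h′ → h Fin.< h′ → ∃[ u ] ∃[ v ] (Branch h u × Branch h′ v × Adj H u v)

  branchSets⇒minor : ∀ {m} → BranchSets m → K m IsMinorOf H
  branchSets⇒minor {m} S = record
    { branch    = branch
    ; connected = λ h → (proj₁ (nonempty h) , branch-complete (proj₂ (nonempty h))) ,
        λ { (u , p) (v , q) → lift p q (connected h (branch-sound p) (branch-sound q)) }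
    ; edges     = edges′
    }
    where
    open BranchSets S
    branch : Fin n → Maybe (Fin m)
    branch v with Finₚ.any? (branch? v)
    ... | yes (h , _) = just h
    ... | no _        = nothing
    branch-complete : ∀ {h v} → Branch h v → branch v ≡ just h
    branch-complete {h} {v} Shv with Finₚ.any? (branch? v)
    ... | yes (h′ , Sh′v) = cong just (disjoint Sh′v Shv)
    ... | no none         = contradiction (h , Shv) none
    branch-sound : ∀ {h v} → branch v ≡ just h → Branch h v
    branch-sound {h} {v} eq with Finₚ.any? (branch? v)
    branch-sound {h} {v} refl | yes (h , Shv) = Shv
    lift : ∀ {h u v} (p : branch u ≡ just h) (q : branch v ≡ just h) →
      Star (StepIn (Branch h)) u v → Star (Adj (inducedClass H branch (just h))) (u , p) (v , q)
    lift p q ε with refl ← just-irrelevant p q = ε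
    lift p q ((uw , _ , Sw) ◅ path) = uw ◅ lift (branch-complete Sw) q path
    edges′ : ∀ h h′ → h ≢ h′ →
      ∃[ u ] ∃[ v ] (branch u ≡ just h × branch v ≡ just h′ × Adj H u v)
    edges′ h h′ h≢h′ with Finₚ.<-cmp h h′
    ... | tri≈ _ h≡h′ _ = contradiction h≡h′ h≢h′
    ... | tri< h<h′ _ _ =
      let u , v , Su , Sv , uv = edges h h′ h<h′ in
      u , v , branch-complete Su , branch-complete Sv , uv
    ... | tri> _ _ h′<h =
      let u , v , Su , Sv , uv = edges h′ h h′<h in
      v , u , branch-complete Sv , branch-complete Su , adj-sym H uv

  AdjTo : Subset n → Fin n → Set
  AdjTo A v = ∃[ a ] (a ∈ A × Adj H a v)

  stepIn-sym : ∀ {S u v} → StepIn S u v → StepIn S v u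
  stepIn-sym (uv , Su , Sv) = adj-sym H uv , Sv , Su

  -- The cycle is cut behind positions i and j; each of the three arcs contains
  -- one of the positions i, j, k, and is hence adjacent to the hub A.
  hubAndCycle⇒K₄ : ∀ A → Nonempty A → (∀ {u v} → u ∈ A → v ∈ A → Star (StepIn (_∈ A)) u v) →
    (C : Cycle H) → let open Cycle C in
    (∀ p → vertex p ∉ A) → ∀ {i j k} → i Fin.< j → j Fin.< k →
    AdjTo A (vertex i) → AdjTo A (vertex j) → AdjTo A (vertex k) →
    K 4 IsMinorOf H
  hubAndCycle⇒K₄ A A≢∅ A-conn C C∉A {i} {j} {k} i<j j<k Ai Aj Ak
    with <⇒inject₁ i<j | <⇒inject₁ j<k
  -- As `i` and `j` precede another position, they have successors `suc i′` and `suc j′`, where the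
  -- next arcs start.
  ... | i′ , refl | j′ , refl = branchSets⇒minor (record
    { Branch = Branch ; branch? = branch? ; disjoint = disjoint ; nonempty = nonempty
    ; connected = connected ; edges = edges })
    where
    open Cycle C
    arc : Fin (3 + m) → Fin 3
    arc p with p Finₚ.≤? i | p Finₚ.≤? j
    ... | yes _ | _     = 0F
    ... | no _  | yes _ = 1F
    ... | no _  | no _  = 2F
    arc≡0 : ∀ {p} → p Fin.≤ i → arc p ≡ 0F
    arc≡0 {p} p≤i with p Finₚ.≤? i | p Finₚ.≤? j
    ... | yes _ | _ = refl
    ... | no p≰i | _ = contradiction p≤i p≰i
    arc≡1 : ∀ {p} → i Fin.< p → p Fin.≤ j → arc p ≡ 1F
    arc≡1 {p} i<p p≤j with p Finₚ.≤? i | p Finₚ.≤? j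
    ... | yes p≤i | _ = contradiction p≤i (ℕₚ.<⇒≱ i<p)
    ... | no _ | yes _ = refl
    ... | no _ | no p≰j = contradiction p≤j p≰j
    arc≡2 : ∀ {p} → j Fin.< p → arc p ≡ 2F
    arc≡2 {p} j<p with p Finₚ.≤? i | p Finₚ.≤? j
    ... | yes p≤i | _ = contradiction p≤i (ℕₚ.<⇒≱ (ℕₚ.<-trans i<j j<p))
    ... | no _ | yes p≤j = contradiction p≤j (ℕₚ.<⇒≱ j<p)
    ... | no _ | no _ = refl
    arc-mono : ∀ {p q} → p Fin.≤ q → arc p Fin.≤ arc q
    arc-mono {p} {q} p≤q with p Finₚ.≤? i | p Finₚ.≤? j | q Finₚ.≤? i | q Finₚ.≤? j
    ... | yes _   | _       | _       | _       = z≤n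
    ... | no p≰i  | _       | yes q≤i | _       = contradiction (ℕₚ.≤-trans p≤q q≤i) p≰i
    ... | no _    | yes _   | no _    | yes _   = s≤s z≤n
    ... | no _    | yes _   | no _    | no _    = s≤s z≤n
    ... | no _    | no p≰j  | no _    | yes q≤j = contradiction (ℕₚ.≤-trans p≤q q≤j) p≰j
    ... | no _    | no _    | no _    | no _    = s≤s (s≤s z≤n)

    Branch : Fin 4 → Fin n → Set
    Branch zero    v = v ∈ A
    Branch (suc h) v = ∃[ p ] (vertex p ≡ v × arc p ≡ h)
    branch? : ∀ v h → Dec (Branch h v)
    branch? v zero    = v ∈? A
    branch? v (suc h) = Finₚ.any? λ p → (vertex p Finₚ.≟ v) ×-dec (arc p Finₚ.≟ h)
    disjoint : ∀ {v h h′} → Branch h v → Branch h′ v → h ≡ h′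
    disjoint {h = zero}  {zero}   _ _ = refl
    disjoint {h = zero}  {suc _}  v∈A (p , refl , _) = contradiction v∈A (C∉A p)
    disjoint {h = suc _} {zero}   (p , refl , _) v∈A = contradiction v∈A (C∉A p)
    disjoint {h = suc _} {suc _}  (p , refl , refl) (p′ , eq , refl) =
      cong (suc ∘ arc) (distinct (sym eq))

    spoke : ∀ h → ∃[ p ] (arc p ≡ h × AdjTo A (vertex p))
    spoke 0F = i , arc≡0 Finₚ.≤-refl , Ai
    spoke 1F = j , arc≡1 i<j Finₚ.≤-refl , Aj
    spoke 2F = k , arc≡2 j<k , Ak
    nonempty : ∀ h → ∃[ v ] Branch h v
    nonempty zero    = A≢∅
    nonempty (suc h) = let p , eq , _ = spoke h in vertex p , p , refl , eq

    -- Walks down the cycle from `q` to `p`. Since `arc` is monotone, every position in between lies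
    -- in the common arc of the two ends.
    arcPath : ∀ q p → p Fin.≤ q → arc p ≡ arc q →
      Star (StepIn (Branch (suc (arc q)))) (vertex q) (vertex p)
    arcPath = <-weakInduction _ (λ { zero _ _ → ε }) extend
      where
      extend : ∀ q → (∀ p → p Fin.≤ inject₁ q → arc p ≡ arc (inject₁ q) →
          Star (StepIn (Branch (suc (arc (inject₁ q))))) (vertex (inject₁ q)) (vertex p)) →
        ∀ p → p Fin.≤ suc q → arc p ≡ arc (suc q) →
          Star (StepIn (Branch (suc (arc (suc q))))) (vertex (suc q)) (vertex p)
      extend q ih p p≤ arc≡ with p Finₚ.≟ suc q
      ... | yes refl = ε
      ... | no p≢ =
        (adj-sym H (step q) , (suc q , refl , refl) , (inject₁ q , refl , arc-q)) ◅
        subst (λ h → Star (StepIn (Branch (suc h))) (vertex (inject₁ q)) (vertex p)) arc-q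
          (ih p p≤q (trans arc≡ (sym arc-q)))
        where
        p≤q : p Fin.≤ inject₁ q
        p≤q = subst (toℕ p ≤_) (sym (Finₚ.toℕ-inject₁ q)) (ℕ.s≤s⁻¹ (Finₚ.≤∧≢⇒< p≤ p≢))
        arc-q : arc (inject₁ q) ≡ arc (suc q)
        arc-q = Finₚ.≤-antisym
          (arc-mono (ℕₚ.≤-trans (ℕₚ.≤-reflexive (Finₚ.toℕ-inject₁ q)) (ℕₚ.n≤1+n _)))
          (subst (Fin._≤ arc (inject₁ q)) arc≡ (arc-mono p≤q))

    connected : ∀ h {u v} → Branch h u → Branch h v → Star (StepIn (Branch h)) u v
    connected zero u∈A v∈A = A-conn u∈A v∈A
    connected (suc h) (p , refl , refl) (q , refl , eq) with Finₚ.≤-total p q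
    ... | inj₁ p≤q = Star.reverse (stepIn-sym {Branch (suc h)})
      (subst (λ h → Star (StepIn (Branch (suc h))) (vertex q) (vertex p)) eq (arcPath q p p≤q (sym eq)))
    ... | inj₂ q≤p = arcPath p q q≤p eq

    edges : ∀ h h′ → h Fin.< h′ → ∃[ u ] ∃[ v ] (Branch h u × Branch h′ v × Adj H u v)
    edges zero (suc h) _ =
      let p , eq , a , a∈A , ap = spoke h in a , vertex p , a∈A , (p , refl , eq) , ap
    edges (suc 0F) (suc 1F) _ = vertex i , vertex (suc i′) ,
      (i , refl , arc≡0 Finₚ.≤-refl) ,
      (suc i′ , refl , arc≡1 (ℕₚ.≤-reflexive (cong suc (Finₚ.toℕ-inject₁ i′)))
        (subst (_< toℕ j) (Finₚ.toℕ-inject₁ i′) i<j)) , step i′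
    edges (suc 1F) (suc 2F) _ = vertex j , vertex (suc j′) ,
      (j , refl , arc≡1 i<j Finₚ.≤-refl) ,
      (suc j′ , refl , arc≡2 (ℕₚ.≤-reflexive (cong suc (Finₚ.toℕ-inject₁ j′)))) , step j′
    -- The closing edge joins the outer arcs: position zero is at most `i`, and the last position is
    -- at least `k`, hence beyond `j`.
    edges (suc 0F) (suc 2F) _ = vertex zero , vertex (fromℕ (2 + m)) ,
      (zero , refl , arc≡0 z≤n) ,
      (fromℕ (2 + m) , refl , arc≡2 (ℕₚ.<-≤-trans j<k (Finₚ.≤fromℕ k))) , adj-sym H closing
    edges (suc _) (suc 0F) (s≤s ())
    edges (suc 1F) (suc 1F) (s≤s (s≤s ()))
    edges (suc 2F) (suc 1F) (s≤s (s≤s ()))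
    edges (suc 2F) (suc 2F) (s≤s (s≤s (s≤s ())))

-- Neighbours of the hub are found on the cycle in no particular order, while cutting it into arcs
-- needs increasing positions.
sortThree : ∀ {n} {P : Fin n → Set} {i j k} → i ≢ j → i ≢ k → j ≢ k → P i → P j → P k →
  ∃[ a ] ∃[ b ] ∃[ c ] (a Fin.< b × b Fin.< c × P a × P b × P c)
sortThree {i = i} {j} {k} i≢j i≢k j≢k Pi Pj Pk with Finₚ.<-cmp i j | Finₚ.<-cmp j k | Finₚ.<-cmp i k
... | tri≈ _ i≡j _ | _            | _            = contradiction i≡j i≢j
... | _            | tri≈ _ j≡k _ | _            = contradiction j≡k j≢k
... | _            | _            | tri≈ _ i≡k _ = contradiction i≡k i≢k
... | tri< i<j _ _ | tri< j<k _ _ | _            = i , j , k , i<j , j<k , Pi , Pj , Pk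
... | tri< _ _ _   | tri> _ _ k<j | tri< i<k _ _ = i , k , j , i<k , k<j , Pi , Pk , Pj
... | tri< i<j _ _ | tri> _ _ _   | tri> _ _ k<i = k , i , j , k<i , i<j , Pk , Pi , Pj
... | tri> _ _ j<i | tri< _ _ _   | tri< i<k _ _ = j , i , k , j<i , i<k , Pj , Pi , Pk
... | tri> _ _ _   | tri< j<k _ _ | tri> _ _ k<i = j , k , i , j<k , k<i , Pj , Pk , Pi
... | tri> _ _ j<i | tri> _ _ k<j | _            = k , j , i , k<j , j<i , Pk , Pj , Pi

-- Pigeonhole: if every `f c` were a value of `g`, choosing indices would inject `Fin (suc d)` into
-- `Fin d`.
avoid : ∀ {X : Set} → (∀ x y → Dec (x ≡ y)) → ∀ {d} {f : Fin (suc d) → X} →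
  Injective _≡_ _≡_ f → (g : Fin d → X) → ∃[ c ] (∀ i → f c ≢ g i)
avoid _≟_ {d} {f} f-inj g
  with Finₚ.any? (λ c → Finₚ.all? λ i → ¬? (f c ≟ g i))
... | yes found = found
... | no none = contradiction (Finₚ.injective⇒≤ index-inj) ℕₚ.1+n≰n
  where
  hit : ∀ c → ∃[ i ] f c ≡ g i
  hit c with Finₚ.any? (λ i → f c ≟ g i)
  ... | yes h = h
  ... | no ¬h = contradiction (c , λ i eq → ¬h (i , eq)) none
  index-inj : Injective _≡_ _≡_ (proj₁ ∘ hit)
  index-inj {c} {c′} eq =
    f-inj (trans (proj₂ (hit c)) (trans (cong g eq) (sym (proj₂ (hit c′)))))

-- Degeneracy of K₄-minor-free graphs

module _ {n : ℕ} (H : Graph (Fin n)) (adj? : ∀ u v → Dec (Adj H u v)) where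

  -- `B-degree` is what survives of minimum degree 3: only a vertex attached to the hub `A` may have
  -- smaller degree inside `B`.
  record Separation (A B : Subset n) : Set where
    field
      A-nonempty  : Nonempty A
      A-connected : ∀ {u v} → u ∈ A → v ∈ A → Star (StepIn H (_∈ A)) u v
      A-disjoint  : ∀ {v} → v ∈ A → v ∉ B
      B-degree    : ∀ b → b ∈ B → AdjTo H A b ⊎ Deg≥3 H B b

  deg≥3-remove-nonNeighbour : ∀ {B s b} → Deg≥3 H B b → ¬ Adj H s b → Deg≥3 H (B - s) b
  deg≥3-remove-nonNeighbour deg ¬sb q q′ with deg q q′
  ... | w , w∈B , bw , w≢q , w≢q′ =
    w , x∈p∧x≢y⇒x∈p-y w∈B (λ { refl → ¬sb (adj-sym H bw) }) , bw , w≢q , w≢q′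

  deg≥3⇒deg≥2-remove : ∀ {B s b} → Deg≥3 H B b → Deg≥2 H (B - s) b
  deg≥3⇒deg≥2-remove {s = s} deg q with deg q s
  ... | w , w∈B , bw , w≢q , w≢s = w , x∈p∧x≢y⇒x∈p-y w∈B w≢s , bw , w≢q

  -- Deleting `v` lowers the degree only of its neighbours, and these are attached to the hub.
  singletonSeparation : ∀ {B v} → (∀ b → b ∈ B → Deg≥3 H B b) → Separation ⁅ v ⁆ (B - v)
  singletonSeparation {B} {v} deg = record
    { A-nonempty  = v , x∈⁅x⁆ v
    ; A-connected = conn
    ; A-disjoint  = λ u∈ u∈B → x∈p-y⇒x≢y u∈B (x∈⁅y⁆⇒x≡y v u∈)
    ; B-degree    = degree
    }
    where
    conn : ∀ {u w} → u ∈ ⁅ v ⁆ → w ∈ ⁅ v ⁆ → Star (StepIn H (_∈ ⁅ v ⁆)) u w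
    conn u∈ w∈ with refl ← x∈⁅y⁆⇒x≡y v u∈ | refl ← x∈⁅y⁆⇒x≡y v w∈ = ε
    degree : ∀ b → b ∈ B - v → AdjTo H ⁅ v ⁆ b ⊎ Deg≥3 H (B - v) b
    degree b b∈ with adj? v b
    ... | yes vb = inj₁ (v , x∈⁅x⁆ v , vb)
    ... | no ¬vb = inj₂ (deg≥3-remove-nonNeighbour (deg b (x∈p-y⇒x∈p b∈)) ¬vb)

  -- The edge from `a` to `s` keeps the hub connected, and a vertex of `B` that loses the neighbour
  -- `s` becomes attached to the hub.
  absorb : ∀ {A B s} → Separation A B → s ∈ B → AdjTo H A s → Separation (A ∪ ⁅ s ⁆) (B - s)
  absorb {A} {B} {s} sep s∈B (a , a∈A , as) = record
    { A-nonempty  = s , s∈A′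
    ; A-connected = conn
    ; A-disjoint  = disj
    ; B-degree    = degree
    }
    where
    open Separation sep
    A′ = A ∪ ⁅ s ⁆
    A⊆A′ : ∀ {v} → v ∈ A → v ∈ A′
    A⊆A′ = x∈p∪q⁺ ∘ inj₁
    s∈A′ : s ∈ A′
    s∈A′ = x∈p∪q⁺ (inj₂ (x∈⁅x⁆ s))
    as′ : StepIn H (_∈ A′) a s
    as′ = as , A⊆A′ a∈A , s∈A′
    conn-A : ∀ {u v} → u ∈ A → v ∈ A → Star (StepIn H (_∈ A′)) u v
    conn-A u∈A v∈A = Star.map (λ { (uv , u∈ , v∈) → uv , A⊆A′ u∈ , A⊆A′ v∈ }) (A-connected u∈A v∈A)
    conn : ∀ {u v} → u ∈ A′ → v ∈ A′ → Star (StepIn H (_∈ A′)) u v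
    conn u∈ v∈ with x∈p∪q⁻ A ⁅ s ⁆ u∈ | x∈p∪q⁻ A ⁅ s ⁆ v∈
    ... | inj₁ u∈A | inj₁ v∈A = conn-A u∈A v∈A
    ... | inj₁ u∈A | inj₂ v∈s with refl ← x∈⁅y⁆⇒x≡y s v∈s = conn-A u∈A a∈A ◅◅ (as′ ◅ ε)
    ... | inj₂ u∈s | inj₁ v∈A with refl ← x∈⁅y⁆⇒x≡y s u∈s =
      stepIn-sym H {_∈ A′} as′ ◅ conn-A a∈A v∈A
    ... | inj₂ u∈s | inj₂ v∈s with refl ← x∈⁅y⁆⇒x≡y s u∈s | refl ← x∈⁅y⁆⇒x≡y s v∈s = ε
    disj : ∀ {v} → v ∈ A′ → v ∉ B - s
    disj v∈ v∈B with x∈p∪q⁻ A ⁅ s ⁆ v∈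
    ... | inj₁ v∈A = A-disjoint v∈A (x∈p-y⇒x∈p v∈B)
    ... | inj₂ v∈s = x∈p-y⇒x≢y v∈B (x∈⁅y⁆⇒x≡y s v∈s)
    degree : ∀ b → b ∈ B - s → AdjTo H A′ b ⊎ Deg≥3 H (B - s) b
    degree b b∈ with B-degree b (x∈p-y⇒x∈p b∈) | adj? s b
    ... | inj₁ (c , c∈A , cb) | _      = inj₁ (c , A⊆A′ c∈A , cb)
    ... | inj₂ _              | yes sb = inj₁ (s , s∈A′ , sb)
    ... | inj₂ deg            | no ¬sb = inj₂ (deg≥3-remove-nonNeighbour deg ¬sb)

  module _ (noK₄ : ¬ (K 4 IsMinorOf H)) where

    -- Induction on the size of `B`, bounded by `fuel`. Absorbing a vertex and restarting inside `B`
    -- both shrink `B`, so the induction hypothesis forbids a cycle in the smaller side.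
    acyclicSide : ∀ fuel {A B} → ∣ B ∣ < fuel → Separation A B → ¬ CycleIn H B
    acyclicSide (suc fuel) {A} {B} B<fuel sep (C , C∈B) = conclude
      where
      open Separation sep
      open Cycle C

      smaller : ∀ {s} → s ∈ B → ∣ B - s ∣ < fuel
      smaller s∈B = ℕₚ.<-≤-trans (x∈p⇒∣p-x∣<∣p∣ s∈B) (ℕ.s≤s⁻¹ B<fuel)

      noCycle-remove : ∀ {s} → s ∈ B → AdjTo H A s → ¬ CycleIn H (B - s)
      noCycle-remove s∈B As = acyclicSide fuel (smaller s∈B) (absorb sep s∈B As)

      -- Were `s` off the cycle `C`, that cycle would survive in `B - s`.
      onCycle : ∀ {s} → s ∈ B → AdjTo H A s → ∃[ i ] vertex i ≡ s
      onCycle {s} s∈B As with Finₚ.any? (λ i → vertex i Finₚ.≟ s)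
      ... | yes found = found
      ... | no none = contradiction
        (C , λ i → x∈p∧x≢y⇒x∈p-y (C∈B i) (λ eq → none (i , eq))) (noCycle-remove s∈B As)

      -- A vertex with three neighbours in `B` keeps two after `s` is deleted, which leaves the
      -- first alternative of `B-degree`.
      lowDegree⇒adjTo : ∀ {s b} → b ∈ B - s → ¬ Deg≥2 H (B - s) b → AdjTo H A b
      lowDegree⇒adjTo {b = b} b∈ ¬deg with B-degree b (x∈p-y⇒x∈p b∈)
      ... | inj₁ Ab  = Ab
      ... | inj₂ deg = contradiction (deg≥3⇒deg≥2-remove deg) ¬deg

      awayFrom : ∀ s t → ∃[ y ] (y ∈ B × y ≢ s × y ≢ t)
      awayFrom s t =
        -- The first three positions carry distinct vertices, of which `s` and `t` account for at
        -- most two.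
        let c , y≢ = avoid Finₚ._≟_ {f = λ (c : Fin 3) → vertex (c ↑ˡ m)}
                       (λ eq → Finₚ.↑ˡ-injective m _ _ (distinct eq)) (s ∷ t ∷ [])
        in vertex (c ↑ˡ m) , C∈B _ , y≢ 0F , y≢ 1F

      adjTo? : ∀ v → Dec (AdjTo H A v)
      adjTo? v = Finₚ.any? λ a → (a ∈? A) ×-dec adj? a v

      conclude : ⊥
      conclude with Finₚ.any? (λ s → (s ∈? B) ×-dec adjTo? s)
      -- `A` has no neighbour in `B`, so all degrees inside `B` are at least 3. One cycle vertex
      -- becomes the new hub; the rest of `B` keeps minimum degree 2 and hence a cycle.
      ... | no none =
        let y , y∈B , y≢v , _ = awayFrom (vertex zero) (vertex zero) in
        acyclicSide fuel (smaller (C∈B zero)) (singletonSeparation deg)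
          (minDegree2⇒cycle H (x∈p∧x≢y⇒x∈p-y y∈B y≢v)
            (λ w w∈ → deg≥3⇒deg≥2-remove (deg w (x∈p-y⇒x∈p w∈))))
        where
        deg : ∀ b → b ∈ B → Deg≥3 H B b
        deg b b∈B with B-degree b b∈B
        ... | inj₁ Ab = contradiction (b , b∈B , Ab) none
        ... | inj₂ d  = d
      ... | yes (s , s∈B , As)
        with Finₚ.any? (λ t → (t ∈? (B - s)) ×-dec ¬? (deg≥2? H adj? (B - s) t))
      ... | no none =
        let y , y∈B , y≢s , _ = awayFrom s s in
        noCycle-remove s∈B As (minDegree2⇒cycle H (x∈p∧x≢y⇒x∈p-y y∈B y≢s)
          (λ w w∈ → decidable-stable (deg≥2? H adj? (B - s) w) (λ ¬d → none (w , w∈ , ¬d))))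
      ... | yes (t , t∈ , ¬deg-t)
        with Finₚ.any? (λ u → (u ∈? (B - s)) ×-dec (¬? (u Finₚ.≟ t) ×-dec ¬? (deg≥2? H adj? (B - s) u)))
      -- `t` is the only vertex of degree below 2, and a single exception still leaves a cycle in
      -- `B - s`.
      ... | no none =
        let y , y∈B , y≢s , y≢t = awayFrom s t in
        noCycle-remove s∈B As (exceptOneMinDegree2⇒cycle H adj? t∈ (x∈p∧x≢y⇒x∈p-y y∈B y≢s) y≢t
          (λ w w∈ w≢t → decidable-stable (deg≥2? H adj? (B - s) w) (λ ¬d → none (w , w∈ , w≢t , ¬d))))
      ... | yes (u , u∈ , u≢t , ¬deg-u)
        with onCycle s∈B As | onCycle (x∈p-y⇒x∈p t∈) (lowDegree⇒adjTo t∈ ¬deg-t)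
           | onCycle (x∈p-y⇒x∈p u∈) (lowDegree⇒adjTo u∈ ¬deg-u)
      -- `s`, `t` and `u` are distinct neighbours of the hub, all on `C`: they give the three
      -- spokes.
      ... | i , refl | j , refl | k , refl =
        let a , b , c , a<b , b<c , Aa , Ab , Ac =
              sortThree {P = λ p → AdjTo H A (vertex p)}
                (λ { refl → x∈p-y⇒x≢y t∈ refl }) (λ { refl → x∈p-y⇒x≢y u∈ refl }) (λ { refl → u≢t refl })
                As (lowDegree⇒adjTo t∈ ¬deg-t) (lowDegree⇒adjTo u∈ ¬deg-u)
        in noK₄ (hubAndCycle⇒K₄ H A A-nonempty A-connected C (λ p p∈A → A-disjoint p∈A (C∈B p))
             a<b b<c Aa Ab Ac)

    K₄-free⇒2-degenerate : IsDegenerate H adj? 2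
    K₄-free⇒2-degenerate B (x , x∈B)
      with Finₚ.any? (λ v → (v ∈? B) ×-dec ¬? (deg≥3? H adj? B v))
    ... | yes (v , v∈B , ¬deg) = v , v∈B , ¬deg≥3⇒covered H adj? ¬deg
    ... | no none =
      let y , y∈B , _ , y≢x , _ = deg x x∈B x x in
      contradiction
        (minDegree2⇒cycle H (x∈p∧x≢y⇒x∈p-y y∈B y≢x)
          (λ w w∈ → deg≥3⇒deg≥2-remove (deg w (x∈p-y⇒x∈p w∈))))
        (acyclicSide (suc ∣ B - x ∣) ℕₚ.≤-refl (singletonSeparation deg))
      where
      deg : ∀ w → w ∈ B → Deg≥3 H B w
      deg w w∈B = decidable-stable (deg≥3? H adj? B w) (λ ¬d → none (w , w∈B , ¬d))

-- Greedy colouring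

-- Because a sign squares to 1, the condition on an edge may be read from either end.
sign*-sym : ∀ s {x y} → x ≡ (s ◃ 1) *ᶻ y → y ≡ (s ◃ 1) *ᶻ x
sign*-sym s {x} {y} refl = begin
  y                               ≡⟨ ℤₚ.*-identityˡ y ⟨
  1ℤ *ᶻ y                         ≡⟨ cong (_*ᶻ y) (square s) ⟨
  ((s ◃ 1) *ᶻ (s ◃ 1)) *ᶻ y       ≡⟨ ℤₚ.*-assoc (s ◃ 1) (s ◃ 1) y ⟩
  (s ◃ 1) *ᶻ ((s ◃ 1) *ᶻ y)       ∎
  where
  open ≡-Reasoning
  square : ∀ s → (s ◃ 1) *ᶻ (s ◃ 1) ≡ 1ℤ
  square Sign.+ = refl
  square Sign.- = refl

unit : Fin 2 → ℤ
unit 0F = 1ℤ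
unit 1F = -1ℤ

unit-injective : Injective _≡_ _≡_ unit
unit-injective {0F} {0F} _ = refl
unit-injective {0F} {1F} ()
unit-injective {1F} {1F} _ = refl

∣unit∣≡1 : ∀ i → ∣ unit i ∣ᶻ ≡ 1
∣unit∣≡1 0F = refl
∣unit∣≡1 1F = refl

module _ {n : ℕ} (H : Graph (Fin n)) (adj? : ∀ u v → Dec (Adj H u v))
         (σ : Fin n → Fin n → Sign) (σ-sym : ∀ u v → σ u v ≡ σ v u) where

  ProperOn : Subset n → (Fin n → ℤ) → Set
  ProperOn B φ = ∀ u v → u ∈ B → v ∈ B → Adj H u v → φ u ≢ (σ u v ◃ 1) *ᶻ φ v

  module _ {d : ℕ} (colour : Fin (suc d) → ℤ) (colour-inj : Injective _≡_ _≡_ colour)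
           (degenerate : IsDegenerate H adj? d) where

    greedyOn : ∀ fuel B → ∣ B ∣ < fuel → Σ[ c ∈ (Fin n → Fin (suc d)) ] ProperOn B (colour ∘ c)
    greedyOn (suc fuel) B B<fuel with nonempty? B
    ... | no empty = const zero , λ u _ u∈B → contradiction (u , u∈B) empty
    ... | yes B≢∅ with degenerate B B≢∅
    ... | v , v∈B , q , cover
      with greedyOn fuel (B - v) (ℕₚ.<-≤-trans (x∈p⇒∣p-x∣<∣p∣ v∈B) (ℕ.s≤s⁻¹ B<fuel))
    -- Each listed vertex `q i` forbids one colour, so one of the `suc d` distinct colours remains
    -- for `v`.
    ... | c , proper with avoid ℤₚ._≟_ colour-inj (λ i → (σ v (q i) ◃ 1) *ᶻ colour (c (q i)))
    ... | new , fresh = c′ , proper′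
      where
      c′ : Fin n → Fin (suc d)
      c′ = updateAt c v (const new)
      at-v : c′ v ≡ new
      at-v = updateAt-updates v c
      off-v : ∀ {u} → u ≢ v → c′ u ≡ c u
      off-v {u} = updateAt-minimal u v c
      new-proper : ∀ w → w ∈ B → Adj H v w → colour new ≢ (σ v w ◃ 1) *ᶻ colour (c w)
      new-proper w w∈B vw with cover w w∈B vw
      ... | i , refl = fresh i
      proper′ : ProperOn B (colour ∘ c′)
      proper′ u w u∈B w∈B uw with u Finₚ.≟ v | w Finₚ.≟ v
      ... | yes refl | yes refl = contradiction uw (adj-irrefl H refl)
      ... | yes refl | no w≢v rewrite at-v | off-v w≢v = new-proper w w∈B uw
      ... | no u≢v | yes refl rewrite at-v | off-v u≢v | σ-sym u v =
        new-proper u u∈B (adj-sym H uw) ∘ sign*-sym (σ v u)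
      ... | no u≢v | no w≢v rewrite off-v u≢v | off-v w≢v =
        proper u w (x∈p∧x≢y⇒x∈p-y u∈B u≢v) (x∈p∧x≢y⇒x∈p-y w∈B w≢v) uw

    degenerate⇒colouring : Σ[ c ∈ (Fin n → Fin (suc d)) ]
      (∀ u v → Adj H u v → colour (c u) ≢ (σ u v ◃ 1) *ᶻ colour (c v))
    degenerate⇒colouring =
      let c , proper = greedyOn (suc ∣ ⊤ {n} ∣) ⊤ ℕₚ.≤-refl in
      c , λ u v → proper u v ∈⊤ ∈⊤

  forest⇒unitColouring : IsForest H → Σ[ c ∈ (Fin n → Fin 2) ]
    (∀ u v → Adj H u v → unit (c u) ≢ (σ u v ◃ 1) *ᶻ unit (c v))
  forest⇒unitColouring acyclic =
    degenerate⇒colouring unit unit-injective (forest⇒1-degenerate H adj? acyclic)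

-- The chromatic number

∈±? : ∀ z k → Dec (z ∈± k)
∈±? z k = (1 ℕₚ.≤? ∣ z ∣ᶻ) ×-dec (∣ z ∣ᶻ ℕₚ.≤? k)

-- Both parities of `c` force the witness `k` to be at most `c`, so a finite search decides
-- membership.
∈M? : ∀ z c → Dec (z ∈M c)
∈M? z c = map′ (λ { (i , p) → toℕ i , p }) bounded
  (Finₚ.any? {suc c} λ i → member? (toℕ i))
  where
  Member : ℕ → Set
  Member k = (c ≡ 2 * k × z ∈± k) ⊎ (c ≡ 2 * k + 1 × (z ≡ 0ℤ ⊎ z ∈± k))
  member? : ∀ k → Dec (Member k)
  member? k = ((c ℕₚ.≟ 2 * k) ×-dec ∈±? z k)
        ⊎-dec ((c ℕₚ.≟ 2 * k + 1) ×-dec ((z ℤₚ.≟ 0ℤ) ⊎-dec ∈±? z k))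
  k≤c : ∀ {k} → Member k → k ≤ c
  k≤c {k} (inj₁ (refl , _)) = ℕₚ.m≤n*m k 2
  k≤c {k} (inj₂ (refl , _)) = ℕₚ.≤-trans (ℕₚ.m≤n*m k 2) (ℕₚ.m≤m+n (2 * k) 1)
  bounded : z ∈M c → ∃[ i ] Member (toℕ i)
  bounded (k , p) = fromℕ< (s≤s (k≤c p)) , subst Member (sym (Finₚ.toℕ-fromℕ< _)) p

∈M⇒∣z∣≤c : ∀ {z c} → z ∈M c → ∣ z ∣ᶻ ≤ c
∈M⇒∣z∣≤c (k , inj₁ (refl , _ , z≤k)) = ℕₚ.≤-trans z≤k (ℕₚ.m≤n*m k 2)
∈M⇒∣z∣≤c (k , inj₂ (refl , inj₁ refl)) = z≤n
∈M⇒∣z∣≤c (k , inj₂ (refl , inj₂ (_ , z≤k))) =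
  ℕₚ.≤-trans z≤k (ℕₚ.≤-trans (ℕₚ.m≤n*m k 2) (ℕₚ.m≤m+n (2 * k) 1))

-- An enumeration, with zero listed twice, of the integers from `- c` to `c`; it makes colourings a
-- finite search space.
fromCode : ∀ c → Fin (suc c + suc c) → ℤ
fromCode c = [ (λ i → + toℕ i) , (λ i → - (+ toℕ i)) ]′ ∘ splitAt (suc c)

fromCode-surjective : ∀ c z → ∣ z ∣ᶻ ≤ c → ∃[ i ] fromCode c i ≡ z
fromCode-surjective c (+ m) m≤c = i ↑ˡ suc c ,
  trans (cong [ _ , _ ]′ (Finₚ.splitAt-↑ˡ (suc c) i (suc c)))
    (cong +_ (Finₚ.toℕ-fromℕ< (s≤s m≤c)))
  where i = fromℕ< (s≤s m≤c)
fromCode-surjective c -[1+ m ] m<c = suc c ↑ʳ i ,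
  trans (cong [ _ , _ ]′ (Finₚ.splitAt-↑ʳ (suc c) (suc c) i))
    (cong (-_ ∘ +_) (Finₚ.toℕ-fromℕ< (s≤s m<c)))
  where i = fromℕ< (s≤s m<c)

module _ {n : ℕ} (G : SimpleSignedGraph n) where

  proper? : ∀ φ → Dec (IsProperColouring G φ)
  proper? φ = Finₚ.all? λ u → Finₚ.all? λ v → edge? u v (label G u v)
    where
    edge? : ∀ u v (l : Maybe Sign) → Dec (∀ s → l ≡ just s → φ u ≢ (s ◃ 1) *ᶻ φ v)
    edge? u v nothing  = yes λ _ ()
    edge? u v (just s) = map′ (λ { ≢ _ refl → ≢ }) (λ p → p s refl)
      (¬? (φ u ℤₚ.≟ (s ◃ 1) *ᶻ φ v))

  -- Allowed colours have absolute value at most `c`, so trying all codes suffices. A decoded code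
  -- agrees with `φ` only pointwise, hence the transport of each condition.
  colourable? : ∀ c → Dec (Colourable G c)
  colourable? c = map′ (λ (code , p) → decode code , p) encode
    (Finₚ.any? λ code → proper? (decode code) ×-dec Finₚ.all? λ v → ∈M? (decode code v) c)
    where
    decode : Fin ((suc c + suc c) ℕ.^ n) → Fin n → ℤ
    decode code = fromCode c ∘ finToFun code
    encode : Colourable G c →
      ∃[ code ] (IsProperColouring G (decode code) × (∀ v → decode code v ∈M c))
    encode (φ , proper , φ∈M) = code ,
      (λ u v s uv eq → proper u v s uv (subst₂ (λ x y → x ≡ (s ◃ 1) *ᶻ y) (decoded u) (decoded v) eq)) ,
      (λ v → subst (_∈M c) (sym (decoded v)) (φ∈M v))
      where
      preimage : ∀ v → ∃[ i ] fromCode c i ≡ φ v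
      preimage v = fromCode-surjective c (φ v) (∈M⇒∣z∣≤c (φ∈M v))
      code = funToFin (proj₁ ∘ preimage)
      decoded : ∀ v → decode code v ≡ φ v
      decoded v = trans (cong (fromCode c) (Finₚ.finToFun-funToFin (proj₁ ∘ preimage) v)) (proj₂ (preimage v))

least : {P : ℕ → Set} → (∀ m → Dec (P m)) → ∀ {b} → P b → ∃[ m ] (IsLeast P m × m ≤ b)
least {P} P? {b} Pb = search b 0 (ℕₚ.+-identityʳ b) (λ _ _ → z≤n)
  where
  -- `m` climbs from zero and stays a lower bound for `P`; `gap` is the distance left to the known
  -- witness `b`.
  search : ∀ gap m → gap + m ≡ b → (∀ j → P j → m ≤ j) → ∃[ m ] (IsLeast P m × m ≤ b)
  search gap m gap+m≡b below with P? m
  ... | yes Pm = m , (Pm , below) , subst (m ≤_) gap+m≡b (ℕₚ.m≤n+m m gap)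
  search zero m refl below | no ¬Pm = contradiction Pb ¬Pm
  search (suc gap) m gap+m≡b below | no ¬Pm =
    search gap (suc m) (trans (ℕₚ.+-suc gap m) gap+m≡b)
      (λ j Pj → ℕₚ.≤∧≢⇒< (below j Pj) (λ { refl → ¬Pm Pj }))

-- The three upper bounds

module _ {n : ℕ} (G : SimpleSignedGraph n) where

  private
    H = underlying G

  colourable⇒chromatic≤ : ∀ {b} → 1 ≤ b → Colourable G b → ∃[ c ] (IsChromaticNumber G c × c ≤ b)
  colourable⇒chromatic≤ 1≤b colouring =
    least (λ c → (1 ℕₚ.≤? c) ×-dec colourable? G c) (1≤b , colouring)

  adj? : ∀ u v → Dec (Adj H u v)
  adj? u v with label G u v
  ... | just s  = yes (s , refl)
  ... | nothing = no λ ()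

  -- Non-edges receive the arbitrary default `Sign.+`; properness consults the sign on edges only.
  sign : Fin n → Fin n → Sign
  sign u v = fromMaybe Sign.+ (label G u v)

  sign-sym : ∀ u v → sign u v ≡ sign v u
  sign-sym u v = cong (fromMaybe Sign.+) (label-sym G u v)

  sign-label : ∀ {u v s} → label G u v ≡ just s → sign u v ≡ s
  sign-label = cong (fromMaybe Sign.+)

  K₄-free⇒3-colourable : ¬ (K 4 IsMinorOf H) → Colourable G 3
  K₄-free⇒3-colourable noK₄ =
    let c , proper = degenerate⇒colouring H adj? sign sign-sym colour colour-inj
                       (K₄-free⇒2-degenerate H adj? noK₄) in
    colour ∘ c ,
    (λ u v s uv → subst (λ s → colour (c u) ≢ (s ◃ 1) *ᶻ colour (c v)) (sign-label uv)
                    (proper u v (s , uv))) ,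
    colour∈M ∘ c
    where
    colour : Fin 3 → ℤ
    colour zero    = 0ℤ
    colour (suc i) = unit i
    colour-inj : Injective _≡_ _≡_ colour
    colour-inj {0F} {0F} _ = refl
    colour-inj {0F} {1F} ()
    colour-inj {0F} {2F} ()
    colour-inj {1F} {0F} ()
    colour-inj {2F} {0F} ()
    colour-inj {suc _} {suc _} eq = cong suc (unit-injective eq)
    colour∈M : ∀ i → colour i ∈M 3
    colour∈M zero    = 1 , inj₂ (refl , inj₁ refl)
    colour∈M (suc i) = 1 , inj₂ (refl , inj₂
      (ℕₚ.≤-reflexive (sym (∣unit∣≡1 i)) , ℕₚ.≤-reflexive (∣unit∣≡1 i)))

  -- Joins the graphs induced by all classes into one graph on `Fin n`, so that a single unit
  -- colouring serves every class.
  monochromatic : ∀ {m} → (Fin n → Fin m) → Graph (Fin n)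
  monochromatic f = record
    { Adj        = λ u v → Adj H u v × f u ≡ f v
    ; adj-sym    = λ (uv , eq) → adj-sym H uv , sym eq
    ; adj-irrefl = λ u≡v (uv , _) → adj-irrefl H u≡v uv
    }

  -- The absolute value of a colour records the class, its sign comes from the unit colouring.
  -- Between classes the absolute values differ, so no edge sign causes a conflict; within a class
  -- the common factor cancels.
  monochromaticForest⇒colourable : ∀ {m k} (f : Fin n → Fin m) → m ≤ k →
    IsForest (monochromatic f) → Colourable G (2 * k)
  monochromaticForest⇒colourable {m} {k} f m≤k acyclic = φ , proper , λ v → k , inj₁ (refl , φ∈± v)
    where
    colouring = forest⇒unitColouring (monochromatic f)
      (λ u v → adj? u v ×-dec (f u Finₚ.≟ f v)) sign sign-sym acyclic
    c = proj₁ colouring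
    φ : Fin n → ℤ
    -- Class numbers start at 0, but 0 is not a colour when `2 * k` colours are used.
    φ v = unit (c v) *ᶻ + suc (toℕ (f v))
    ∣φ∣ : ∀ v → ∣ φ v ∣ᶻ ≡ suc (toℕ (f v))
    ∣φ∣ v = begin
      ∣ φ v ∣ᶻ                                ≡⟨ ℤₚ.abs-* (unit (c v)) (+ suc (toℕ (f v))) ⟩
      ∣ unit (c v) ∣ᶻ * suc (toℕ (f v))       ≡⟨ cong (_* suc (toℕ (f v))) (∣unit∣≡1 (c v)) ⟩
      1 * suc (toℕ (f v))                     ≡⟨ ℕₚ.*-identityˡ _ ⟩
      suc (toℕ (f v))                         ∎
      where open ≡-Reasoning
    φ∈± : ∀ v → φ v ∈± k
    φ∈± v rewrite ∣φ∣ v = s≤s z≤n , ℕₚ.≤-trans (Finₚ.toℕ<n (f v)) m≤k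
    ∣sign*∣ : ∀ s z → ∣ (s ◃ 1) *ᶻ z ∣ᶻ ≡ ∣ z ∣ᶻ
    ∣sign*∣ s z = begin
      ∣ (s ◃ 1) *ᶻ z ∣ᶻ      ≡⟨ ℤₚ.abs-* (s ◃ 1) z ⟩
      ∣ s ◃ 1 ∣ᶻ * ∣ z ∣ᶻ    ≡⟨ cong (_* ∣ z ∣ᶻ) (ℤₚ.abs-◃ s 1) ⟩
      1 * ∣ z ∣ᶻ             ≡⟨ ℕₚ.*-identityˡ _ ⟩
      ∣ z ∣ᶻ                 ∎
      where open ≡-Reasoning
    proper : IsProperColouring G φ
    proper u v s uv eq = proj₂ colouring u v ((s , uv) , fu≡fv)
      (ℤₚ.*-cancelʳ-≡ _ _ (+ suc (toℕ (f v))) (begin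
        unit (c u) *ᶻ + suc (toℕ (f v))                     ≡⟨ cong (λ i → unit (c u) *ᶻ + suc (toℕ i)) fu≡fv ⟨
        φ u                                                 ≡⟨ eq ⟩
        (s ◃ 1) *ᶻ φ v                                      ≡⟨ ℤₚ.*-assoc (s ◃ 1) (unit (c v)) _ ⟨
        (s ◃ 1) *ᶻ unit (c v) *ᶻ + suc (toℕ (f v))          ≡⟨ cong (λ s → (s ◃ 1) *ᶻ unit (c v) *ᶻ + suc (toℕ (f v))) (sign-label uv) ⟨
        (sign u v ◃ 1) *ᶻ unit (c v) *ᶻ + suc (toℕ (f v))   ∎))
      where
      open ≡-Reasoning
      fu≡fv : f u ≡ f v
      fu≡fv = Finₚ.toℕ-injective (ℕₚ.suc-injective (begin
        suc (toℕ (f u))           ≡⟨ ∣φ∣ u ⟨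
        ∣ φ u ∣ᶻ                  ≡⟨ cong ∣_∣ᶻ eq ⟩
        ∣ (s ◃ 1) *ᶻ φ v ∣ᶻ       ≡⟨ ∣sign*∣ s (φ v) ⟩
        ∣ φ v ∣ᶻ                  ≡⟨ ∣φ∣ v ⟩
        suc (toℕ (f v))           ∎))

  -- `f` is constant along a monochromatic cycle, which therefore lies in a single class.
  classForests⇒monochromaticForest : ∀ {m} (f : Fin n → Fin m) →
    (∀ i → IsForest (inducedClass H f i)) → IsForest (monochromatic f)
  classForests⇒monochromaticForest f acyclic C = acyclic (f (vertex zero)) (record
    { m        = m
    ; vertex   = λ i → vertex i , constant i
    ; distinct = λ eq → distinct (cong proj₁ eq)
    ; step     = λ i → proj₁ (step i)
    ; closing  = proj₁ closing
    })
    where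
    open Cycle C
    constant : ∀ i → f (vertex i) ≡ f (vertex zero)
    constant = <-weakInduction _ refl (λ i eq → trans (sym (proj₂ (step i))) eq)

  edgeForests-mono : ∀ {m m′} → m ≤ m′ → EdgeForestPartition H m → EdgeForestPartition H m′
  edgeForests-mono {m} {m′} m≤m′ (f , acyclic) = f′ , acyclic′
    where
    f′ : EdgeClasses H m′
    f′ = record
      { class     = λ e → inject≤ (class f e) m≤m′
      ; class-sym = λ e e′ → cong (λ i → inject≤ i m≤m′) (class-sym f e e′)
      }
    acyclic′ : ∀ i → IsForest (edgeClass H f′ i)
    -- `i` ranges over the added empty classes too, so the old class is read off the first edge of
    -- `C`.
    acyclic′ i C = acyclic (class f (proj₁ (Cycle.step C zero))) (mapCycle
      (λ (e , eq) → e , Finₚ.inject≤-injective m≤m′ m≤m′ _ _ (trans eq (sym (proj₂ (Cycle.step C zero)))))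
      C)

  edgeClass? : ∀ {m} (f : EdgeClasses H m) i u v → Dec (Adj (edgeClass H f i) u v)
  edgeClass? f i u v with adj? u v
  ... | no ¬e = no (¬e ∘ proj₁)
  ... | yes e = map′ (e ,_) (λ (e′ , eq) → trans (same-class e e′) eq) (class f e Finₚ.≟ i)
    where
    same-class : ∀ (e e′ : Adj H u v) → class f e ≡ class f e′
    -- Both proofs of adjacency are compared with the reversed edge.
    same-class e e′ = trans (class-sym f e (adj-sym H e)) (class-sym f (adj-sym H e) e′)

  twoForests⇒colourable : EdgeForestPartition H 2 → Colourable G 4
  twoForests⇒colourable (f , acyclic) =
    monochromaticForest⇒colourable c ℕₚ.≤-refl
      (acyclic 0F ∘ mapCycle λ ((e , cu≡cv)) → e , class≡0 e cu≡cv)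
    where
    -- With every sign positive, a unit colouring is an ordinary proper 2-colouring, here of the
    -- second forest.
    colouring = forest⇒unitColouring (edgeClass H f 1F) (edgeClass? f 1F)
      (λ _ _ → Sign.+) (λ _ _ → refl) (acyclic 1F)
    c = proj₁ colouring
    class≡0 : ∀ {u v} (e : Adj H u v) → c u ≡ c v → class f e ≡ 0F
    class≡0 {u} {v} e cu≡cv with class f e in eq
    ... | 0F = refl
    ... | 1F = contradiction
      (trans (cong unit cu≡cv) (sym (ℤₚ.*-identityˡ (unit (c v)))))
      (proj₂ colouring u v (e , eq))

proposition2p4 : ∀ n → .{{_ : NonZero n}} → (G : SimpleSignedGraph n) →
    (¬ (K 4 IsMinorOf underlying G) →
    ∃[ c ] (IsChromaticNumber G c × c ≤ 3))
    ×
    ((∃[ a′ ] (IsEdgeArboricity (underlying G) a′ × a′ ≤ 2)) →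
    ∃[ c ] (IsChromaticNumber G c × c ≤ 4))
    ×
    (∀ k → 1 ≤ k → (∃[ a ] (IsVertexArboricity (underlying G) a × a ≤ k)) →
    ∃[ c ] (IsChromaticNumber G c × c ≤ 2 * k))
proposition2p4 n G =
  (λ noK₄ → colourable⇒chromatic≤ G (s≤s z≤n) (K₄-free⇒3-colourable G noK₄)) ,
  (λ (_ , (partition , _) , a′≤2) → colourable⇒chromatic≤ G (s≤s z≤n)
    (twoForests⇒colourable G (edgeForests-mono G a′≤2 partition))) ,
  (λ k 1≤k (_ , ((f , forests) , _) , a≤k) → colourable⇒chromatic≤ G
    (ℕₚ.≤-trans 1≤k (ℕₚ.m≤n*m k 2))
    (monochromaticForest⇒colourable G f a≤k (classForests⇒monochromaticForest G f forests)))
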